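{- If $\mathcal{F}$ is a finite union-closed family of finite sets such that $\emptyset \in \mathcal{F}$ and $J(\mathcal{F})$ is a non-empty graph, then $\mathcal{F}$ has the density property; that is, there is $U \in J(\mathcal{F})$ such that $\left|\{V \in \mathcal{F} \mid U \subseteq V\}\right| \leq \frac{1}{2}|\mathcal{F}|$.
   Context: A family $\mathcal{F}$ is union-closed iff $U \cup V \in \mathcal{F}$ for all $U, V \in \mathcal{F}$. A generator of $\mathcal{F}$ is a member $U$ such that whenever $\mathcal{G} \subseteq \mathcal{F}$ is non-empty and $\bigcup \mathcal{G} = U$, then $U \in \mathcal{G}$. $J(\mathcal{F})$ is the family of non-empty generators of $\mathcal{F}$ (equivalently, the proper join-irreducibles of the lattice $\mathcal{F}$ ordered by inclusion). A family of sets is called a graph iff each of its members has at most two elements. -}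

module Defs where

open import Data.Nat.Base using (ℕ; _≤_; _*_)
open import Data.Fin.Subset using (Subset; Nonempty; ∣_∣; ⋃; _∪_)
open import Data.Fin.Subset.Properties using (_⊆?_)
open import Data.List.Base using (List; []; length; filter)
open import Data.List.Membership.Propositional using (_∈_)
open import Data.List.Relation.Binary.Subset.Propositional using (_⊆_)
open import Data.List.Relation.Unary.Unique.Propositional using (Unique)
open import Data.Product.Base using (_×_; ∃-syntax)
open import Level using (0ℓ)
open import Relation.Binary.PropositionalEquality.Core using (_≡_; _≢_)
open import Relation.Unary using (Pred)

-- A finite family of finite sets has a finite union; enumerating that union
-- makes the members subsets of Fin n. Since the enumeration has no repetitions,
-- the cardinality of the family is the length of the list.
record Family (n : ℕ) : Set where
  field
    members : List (Subset n)
    unique  : Unique members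

open Family public

private variable
  n : ℕ

infix 4 _∈ᶠ_

_∈ᶠ_ : Subset n → Family n → Set
U ∈ᶠ F = U ∈ members F

card : Family n → ℕ
card F = length (members F)

UnionClosed : Family n → Set
UnionClosed F = ∀ U V → U ∈ᶠ F → V ∈ᶠ F → (U ∪ V) ∈ᶠ F

-- The subfamily G is a list that may repeat members, which affects neither
-- its union nor membership in it. The requirement G ≢ [] matters for U = ∅,
-- since ⋃ [] = ⊥ is the empty set.
Generator : Family n → Pred (Subset n) 0ℓ
Generator F U =
  U ∈ᶠ F × (∀ G → G ⊆ members F → G ≢ [] → ⋃ G ≡ U → U ∈ G)

J : Family n → Pred (Subset n) 0ℓ
J F U = Generator F U × Nonempty U

IsGraph : Pred (Subset n) 0ℓ → Set
IsGraph P = ∀ U → P U → ∣ U ∣ ≤ 2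

-- ∣{ V ∈ F ∣ U ⊆ V }∣
countAbove : Family n → Subset n → ℕ
countAbove F U = length (filter (U ⊆?_) (members F))

DensityProperty : Family n → Set
DensityProperty F = ∃[ U ] (J F U × 2 * countAbove F U ≤ card F)

{-# OPTIONS --safe #-}
-- A set W belongs to F iff every x ∈ W is a loop ({x} ∈ F) or has a neighbour in W
-- ({x,y} ∈ F). Take i of minimal degree among the vertices that are no loops but have
-- neighbours. For a neighbour s of i, adding and removing i shows that the edge {s,i} is
-- light as soon as
--   b(s) = #{ W ∈ F ∣ s , i ∈ W , W − i ∉ F }  ≤  c(s) = #{ W ∈ F ∣ s ∉ W },
-- so it suffices that Σ b(s) ≤ Σ c(s) over the neighbours s of i. If W − i ∉ F, some
-- non-loop t has i as its only neighbour in W; put D = W − i − t, which misses i and all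
-- neighbours of t. The pair (s , W) is charged to a member V ∌ t built from D:
-- for s = t to V = D or D + i; for s ≠ t, as deg i ≤ deg t, we can choose injectively a
-- neighbour q ≠ i of t and take V among D + q, D + q + i, D + q + z and D + q + z + i, where
-- z ≠ t is a neighbour of q. If D ∉ F then i has two such leaves in W, so (s , W) may be
-- charged half to each, and if D ∈ F both D + ⋯ and D + i + ⋯ are available. To stay in ℕ,
-- everything is doubled by a Boolean, and injectivity of the charging is obtained from a
-- decoding map that recovers (s , W) and the Boolean. If there is no such vertex i, F is a
-- power set and every singleton will do.

module Submission where

open import Defs
open import Data.Bool.Base using (Bool; true; false; if_then_else_)
import Data.Bool.Properties as Bool
open import Data.Fin.Base using (Fin; zero; suc)
open import Data.Fin.Properties using (_≟_; any?; all?)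
open import Data.Fin.Subset using (Subset; ⊥; ⁅_⁆; _∪_; _-_; _∈_; _∉_; _⊆_; ⋃; ∣_∣)
open import Data.Fin.Subset.Properties using (_∈?_; _⊆?_; _⊂?_; ⊆-antisym; ∪-comm; ∉⊥; x∈⁅x⁆; x∈⁅y⁆⇒x≡y; x∈p∪q⁻; x∈p∪q⁺; p─q⊆p; x∈p∧x≢y⇒x∈p-y; x∈p⇒∣p-x∣<∣p∣; p⊂q⇒∣p∣<∣q∣)
open import Data.List.Base using (List; []; _∷_; [_]; _++_; length; map; filter; concatMap; cartesianProduct; allFin)
open import Data.List.Extrema.Nat using (argmin; argmin-all; f[argmin]≤f[xs])
open import Data.List.Membership.Propositional using (find; lose) renaming (_∈_ to _∈ˡ_)
open import Data.List.Membership.Propositional.Properties using (∈-∃++; ∈-map⁺; ∈-map⁻; ∈-++⁺ˡ; ∈-++⁺ʳ; ∈-++⁻; ∈-filter⁺; ∈-filter⁻; ∈-allFin; ∈-cartesianProduct⁺; ∈-cartesianProduct⁻)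
open import Data.List.Properties using (length-map; length-++; length-filter; filter-notAll; filter-≐)
open import Data.List.Relation.Unary.All as All using (All; []; _∷_)
open import Data.List.Relation.Unary.AllPairs using ([]; _∷_)
open import Data.List.Relation.Unary.Any as Any using (here; there)
open import Data.List.Relation.Unary.Unique.Propositional using (Unique)
open import Data.List.Relation.Unary.Unique.Propositional.Properties as Unique using (Unique[x∷xs]⇒x∉xs)
open import Data.Nat.Base using (ℕ; suc; _+_; _*_; _≤_; _<_; z≤n; s≤s; s≤s⁻¹)
open import Data.Nat.Induction using (<-wellFounded; Acc; acc)
open import Data.Nat.Properties using (module ≤-Reasoning; _≤?_; ≤-refl; ≤-trans; ≤-reflexive; <⇒≤; <⇒≱; ≰⇒>; m≤n⇒m≤1+n; +-suc; +-assoc; +-identityʳ; +-mono-≤; +-mono-<-≤; +-monoʳ-≤; +-monoˡ-≤; *-monoˡ-<)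
open import Data.Product.Base using (∃; ∃₂; _×_; _,_; proj₁; proj₂)
open import Data.Sum.Base using (_⊎_; inj₁; inj₂)
open import Data.Unit.Base using (tt)
open import Data.Vec.Base using (_∷_; there)
open import Data.Vec.Properties using (≡-dec)
open import Function.Base using (_∘_; id; case_of_)
open import Level using (0ℓ)
open import Relation.Binary.Definitions using (DecidableEquality)
open import Relation.Binary.PropositionalEquality using (_≡_; _≢_; refl; sym; trans; cong; cong₂; subst; subst₂; ≢-sym)
open import Relation.Nullary using (¬_; Dec; yes; no; does; contradiction)
open import Relation.Nullary.Decidable using (_×-dec_; _⊎-dec_; _→-dec_; ¬?; dec-true; dec-false)
open import Relation.Unary using (Pred; Decidable; Satisfiable)
open import Relation.Unary.Properties using (U?)

-- Counting in lists.

module _ {a} {A : Set a} where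

  length-delete : ∀ (xs : List A) {x ys} → length (xs ++ [ x ] ++ ys) ≡ suc (length (xs ++ ys))
  length-delete []       = refl
  length-delete (_ ∷ xs) = cong suc (length-delete xs)

  unique-⊆⇒length-≤ : ∀ {xs ys : List A} → Unique xs → (∀ {x} → x ∈ˡ xs → x ∈ˡ ys) → length xs ≤ length ys
  unique-⊆⇒length-≤ {[]}     _ _ = z≤n
  unique-⊆⇒length-≤ {x ∷ xs} u@(_ ∷ uxs) xs⊆ys with ∈-∃++ (xs⊆ys (here refl))
  ... | as , bs , refl = ≤-trans (s≤s (unique-⊆⇒length-≤ uxs xs⊆)) (≤-reflexive (sym (length-delete as)))
    where
    xs⊆ : ∀ {z} → z ∈ˡ xs → z ∈ˡ as ++ bs
    xs⊆ z∈xs with ∈-++⁻ as (xs⊆ys (there z∈xs))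
    ... | inj₁ z∈as         = ∈-++⁺ˡ z∈as
    ... | inj₂ (here refl)  = contradiction z∈xs (Unique[x∷xs]⇒x∉xs u)
    ... | inj₂ (there z∈bs) = ∈-++⁺ʳ as z∈bs

  -- `map f ys` contains all of `xs`. An injection of `xs` into `ys` is thus given by its left
  -- inverse `f`, so preimages may be found by cases without a separate proof of injectivity.
  length-≤-by-decoding : ∀ {b} {B : Set b} {xs : List A} {ys : List B} (f : B → A) → Unique xs →
    (∀ {x} → x ∈ˡ xs → ∃ λ y → y ∈ˡ ys × f y ≡ x) → length xs ≤ length ys
  length-≤-by-decoding {ys = ys} f uxs cover = ≤-trans
    (unique-⊆⇒length-≤ uxs λ x∈xs → let y , y∈ys , fy≡x = cover x∈xs in subst (_∈ˡ _) fy≡x (∈-map⁺ f y∈ys))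
    (≤-reflexive (length-map f ys))

  module _ {p q r} {P : Pred A p} {Q : Pred A q} {R : Pred A r}
           (P? : Decidable P) (Q? : Decidable Q) (R? : Decidable R) where

    count-disjoint : (∀ {x} → P x → ¬ Q x) → (∀ {x} → P x → R x) → (∀ {x} → Q x → R x) →
      ∀ xs → length (filter P? xs) + length (filter Q? xs) ≤ length (filter R? xs)
    count-disjoint P¬Q P⇒R Q⇒R [] = z≤n
    count-disjoint P¬Q P⇒R Q⇒R (x ∷ xs) with ih ← count-disjoint P¬Q P⇒R Q⇒R xs | P? x | Q? x | R? x
    ... | yes p | yes q | _     = contradiction q (P¬Q p)
    ... | yes p | no _  | yes _ = s≤s ih
    ... | yes p | no _  | no ¬r = contradiction (P⇒R p) ¬r
    ... | no _  | yes q | yes _ = ≤-trans (≤-reflexive (+-suc _ _)) (s≤s ih)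
    ... | no _  | yes q | no ¬r = contradiction (Q⇒R q) ¬r
    ... | no _  | no _  | yes _ = m≤n⇒m≤1+n ih
    ... | no _  | no _  | no _  = ih

    count-cover : (∀ {x} → P x → Q x ⊎ R x) →
      ∀ xs → length (filter P? xs) ≤ length (filter Q? xs) + length (filter R? xs)
    count-cover cov [] = z≤n
    count-cover cov (x ∷ xs) with ih ← count-cover cov xs | P? x | Q? x | R? x
    ... | yes p | no ¬q | no ¬r = contradiction (cov p) λ { (inj₁ q) → ¬q q ; (inj₂ r) → ¬r r }
    ... | yes p | yes _ | no _  = s≤s ih
    ... | yes p | no _  | yes _ = ≤-trans (s≤s ih) (≤-reflexive (sym (+-suc _ _)))
    ... | yes p | yes _ | yes _ = s≤s (≤-trans ih (+-monoʳ-≤ _ (m≤n⇒m≤1+n ≤-refl)))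
    ... | no _  | no _  | no _  = ih
    ... | no _  | yes _ | no _  = m≤n⇒m≤1+n ih
    ... | no _  | no _  | yes _ = ≤-trans ih (+-monoʳ-≤ _ (m≤n⇒m≤1+n ≤-refl))
    ... | no _  | yes _ | yes _ = m≤n⇒m≤1+n (≤-trans ih (+-monoʳ-≤ _ (m≤n⇒m≤1+n ≤-refl)))

  length-cartesianProduct-Bool : ∀ (xs : List A) → length (cartesianProduct xs (false ∷ true ∷ [])) ≡ length xs * 2
  length-cartesianProduct-Bool []       = refl
  length-cartesianProduct-Bool (_ ∷ xs) = cong (2 +_) (length-cartesianProduct-Bool xs)

  module _ (_≟ᴬ_ : DecidableEquality A) where

    zipLookup : List A → List A → A → A
    zipLookup (x ∷ xs) (y ∷ ys) z = if does (z ≟ᴬ y) then x else zipLookup xs ys z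
    -- Junk value: `z` is no key with a value in `xs`.
    zipLookup _        _        z = z

    zipLookup-onto : ∀ {xs ys} → Unique ys → length xs ≤ length ys →
      ∀ {x} → x ∈ˡ xs → ∃ λ y → y ∈ˡ ys × zipLookup xs ys y ≡ x
    zipLookup-onto {x ∷ xs} {y ∷ ys} _ _ (here refl) =
      y , here refl , cong (if_then x else zipLookup xs ys y) (dec-true (y ≟ᴬ y) refl)
    zipLookup-onto {x ∷ xs} {y ∷ ys} u@(_ ∷ uys) (s≤s le) (there x∈xs)
      with z , z∈ys , eq ← zipLookup-onto uys le x∈xs =
      z , there z∈ys ,
      trans (cong (if_then x else zipLookup xs ys z)
              (dec-false (z ≟ᴬ y) λ { refl → contradiction z∈ys (Unique[x∷xs]⇒x∉xs u) }))
            eq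

-- Disjoint sums of lists.

module _ {a b} {A : Set a} {B : Set b} where

  -- A disjoint sum, so that its length is the sum of the lengths of the `h x`; sums over the
  -- neighbours of a vertex are compared in this form.
  tagged : List A → (A → List B) → List (A × B)
  tagged xs h = concatMap (λ x → map (x ,_) (h x)) xs

  ∈-tagged⁺ : ∀ {xs x y} (h : A → List B) → x ∈ˡ xs → y ∈ˡ h x → (x , y) ∈ˡ tagged xs h
  ∈-tagged⁺ h (here refl)  y∈ = ∈-++⁺ˡ (∈-map⁺ _ y∈)
  ∈-tagged⁺ {x′ ∷ _} h (there x∈) y∈ = ∈-++⁺ʳ (map (x′ ,_) (h x′)) (∈-tagged⁺ h x∈ y∈)

  ∈-tagged⁻ : ∀ xs {x y} (h : A → List B) → (x , y) ∈ˡ tagged xs h → x ∈ˡ xs × y ∈ˡ h x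
  ∈-tagged⁻ (x ∷ xs) h p with ∈-++⁻ (map (x ,_) (h x)) p
  ... | inj₁ q with _ , y∈ , refl ← ∈-map⁻ (x ,_) q = here refl , y∈
  ... | inj₂ q with x∈ , y∈ ← ∈-tagged⁻ xs h q = there x∈ , y∈

  tagged-unique : ∀ {xs} (h : A → List B) → Unique xs → (∀ x → Unique (h x)) → Unique (tagged xs h)
  tagged-unique h [] uh = []
  tagged-unique {x ∷ xs} h u@(_ ∷ uxs) uh =
    Unique.++⁺ (Unique.map⁺ (cong proj₂) (uh x)) (tagged-unique h uxs uh) disjoint
    where
    disjoint : ∀ {v} → v ∈ˡ map (x ,_) (h x) × v ∈ˡ tagged xs h → _
    disjoint (p , q) with _ , _ , refl ← ∈-map⁻ (x ,_) p =
      Unique[x∷xs]⇒x∉xs u (proj₁ (∈-tagged⁻ xs h q))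

  length-tagged-≤ : ∀ xs (g h : A → List B) → (∀ {x} → x ∈ˡ xs → length (g x) ≤ length (h x)) →
    length (tagged xs g) ≤ length (tagged xs h)
  length-tagged-≤ [] g h le = z≤n
  length-tagged-≤ (x ∷ xs) g h le
    rewrite length-++ (map (x ,_) (g x)) {tagged xs g} | length-++ (map (x ,_) (h x)) {tagged xs h}
          | length-map (x ,_) (g x) | length-map (x ,_) (h x) =
    +-mono-≤ (le (here refl)) (length-tagged-≤ xs g h (le ∘ there))

  length-tagged-< : ∀ {x₀} xs (g h : A → List B) → x₀ ∈ˡ xs →
    (∀ {x} → x ∈ˡ xs → length (g x) < length (h x)) → length (tagged xs g) < length (tagged xs h)
  -- The membership of `x₀` excludes the empty list, where strictness fails; here the head alone
  -- supplies it.
  length-tagged-< (x ∷ xs) g h _ lt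
    rewrite length-++ (map (x ,_) (g x)) {tagged xs g} | length-++ (map (x ,_) (h x)) {tagged xs h}
          | length-map (x ,_) (g x) | length-map (x ,_) (h x) =
    +-mono-<-≤ (lt (here refl)) (length-tagged-≤ xs g h (<⇒≤ ∘ lt ∘ there))

-- Subsets with one element added or removed.

private variable
  n : ℕ

infixl 6 _＋_ _−_

-- Opaque, so that unification recovers W and x from W ＋ x and W − x.
opaque

  _＋_ : Subset n → Fin n → Subset n
  W ＋ x = ⁅ x ⁆ ∪ W

  _−_ : Subset n → Fin n → Subset n
  W − x = W - x

  x∉W−x : ∀ (W : Subset n) x → x ∉ W − x
  x∉W−x (_ ∷ W) zero    ()
  x∉W−x (_ ∷ W) (suc x) (there x∈) = x∉W−x W x x∈

module _ {W : Subset n} {x : Fin n} where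

  opaque
    unfolding _＋_ _−_

    ∈-＋-new : x ∈ W ＋ x
    ∈-＋-new = x∈p∪q⁺ (inj₁ (x∈⁅x⁆ x))

    ∈-＋-old : W ⊆ W ＋ x
    ∈-＋-old y∈W = x∈p∪q⁺ {p = ⁅ x ⁆} (inj₂ y∈W)

    ∈-＋⁻ : ∀ {y} → y ∈ W ＋ x → y ≡ x ⊎ y ∈ W
    ∈-＋⁻ y∈ with x∈p∪q⁻ ⁅ x ⁆ W y∈
    ... | inj₁ y∈⁅x⁆ = inj₁ (x∈⁅y⁆⇒x≡y x y∈⁅x⁆)
    ... | inj₂ y∈W   = inj₂ y∈W

    ∈-−⁺ : ∀ {y} → y ∈ W → y ≢ x → y ∈ W − x
    ∈-−⁺ = x∈p∧x≢y⇒x∈p-y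

    ∈-−⁻ : ∀ {y} → y ∈ W − x → y ∈ W × y ≢ x
    ∈-−⁻ y∈ = p─q⊆p W ⁅ x ⁆ y∈ , λ { refl → x∉W−x W x y∈ }

  ∉-＋ : ∀ {y} → y ≢ x → y ∉ W → y ∉ W ＋ x
  ∉-＋ y≢x y∉W y∈ with ∈-＋⁻ y∈
  ... | inj₁ y≡x = y≢x y≡x
  ... | inj₂ y∈W = y∉W y∈W

module _ {W : Subset n} {x : Fin n} where

  −-＋-cancel : x ∈ W → W − x ＋ x ≡ W
  −-＋-cancel x∈W = ⊆-antisym
    (λ y∈ → case ∈-＋⁻ y∈ of λ { (inj₁ refl) → x∈W ; (inj₂ y∈W−x) → proj₁ (∈-−⁻ y∈W−x) })
    (λ {y} y∈W → case y ≟ x of λ { (yes refl) → ∈-＋-new ; (no y≢x) → ∈-＋-old (∈-−⁺ y∈W y≢x) })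

  ＋-−-cancel : x ∉ W → W ＋ x − x ≡ W
  ＋-−-cancel x∉W = ⊆-antisym
    (λ y∈ → case ∈-−⁻ y∈ of λ (y∈W＋x , y≢x) → case ∈-＋⁻ y∈W＋x of λ
      { (inj₁ y≡x) → contradiction y≡x y≢x ; (inj₂ y∈W) → y∈W })
    (λ y∈W → ∈-−⁺ (∈-＋-old y∈W) λ { refl → x∉W y∈W })

  −-absent : x ∉ W → W − x ≡ W
  −-absent x∉W = ⊆-antisym (proj₁ ∘ ∈-−⁻) (λ y∈W → ∈-−⁺ y∈W λ { refl → x∉W y∈W })

module _ {W : Subset n} where

  singleton-⊆ : ∀ {x} → x ∈ W → ⁅ x ⁆ ⊆ W
  singleton-⊆ {x} x∈W y∈ = subst (_∈ W) (sym (x∈⁅y⁆⇒x≡y x y∈)) x∈W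

  pair-⊆ : ∀ {x y} → x ∈ W → y ∈ W → ⁅ x ⁆ ∪ ⁅ y ⁆ ⊆ W
  pair-⊆ {x} {y} x∈W y∈W z∈ with x∈p∪q⁻ ⁅ x ⁆ ⁅ y ⁆ z∈
  ... | inj₁ z∈x = singleton-⊆ x∈W z∈x
  ... | inj₂ z∈y = singleton-⊆ y∈W z∈y

-- At most two elements satisfying P: pick false and pick true are distinct as soon
-- as two distinct elements satisfy P, and pick returns the junk value d if there is none.
module Pick (d : Fin n) {P : Pred (Fin n) 0ℓ} (P? : Decidable P) where

  first : Fin n
  first with any? P?
  ... | yes (x , _) = x
  ... | no _        = d

  Other : Pred (Fin n) 0ℓ
  Other x = P x × x ≢ first

  other? : Dec (∃ Other)
  other? = any? λ x → P? x ×-dec ¬? (x ≟ first)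

  second : Fin n
  second with other?
  ... | yes (x , _) = x
  ... | no _        = first

  pick : Bool → Fin n
  pick false = first
  pick true  = second

  first-sat : ∃ P → P first
  first-sat ∃P with any? P?
  ... | yes (_ , Px) = Px
  ... | no ¬∃P       = contradiction ∃P ¬∃P

  pick-sat : ∃ P → ∀ b → P (pick b)
  pick-sat ∃P false = first-sat ∃P
  pick-sat ∃P true with other?
  ... | yes (_ , Px , _) = Px
  ... | no _             = first-sat ∃P

  pick-distinct : ∀ {x y} → P x → P y → x ≢ y → first ≢ second
  pick-distinct {x} {y} Px Py x≢y with other?
  ... | yes (_ , _ , z≢) = z≢ ∘ sym
  ... | no ¬other with x ≟ first | y ≟ first
  ...   | no x≢    | _        = contradiction (x , Px , x≢) ¬other
  ...   | yes _    | no y≢    = contradiction (y , Py , y≢) ¬other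
  ...   | yes refl | yes y≡   = contradiction (sym y≡) x≢y

  -- If `first` is `y` and `y ≢ x`, then `second` differs from `first` and can only be `x`.
  pick-onto : ∀ {x y} → P x → (∀ {z} → P z → z ≡ x ⊎ z ≡ y) → ∃ λ b → pick b ≡ x
  pick-onto {x} {y} Px cover with x ≟ y
  ... | yes refl with cover (pick-sat (x , Px) false)
  ...   | inj₁ eq = false , eq
  ...   | inj₂ eq = false , eq
  pick-onto {x} {y} Px cover | no x≢y with cover (pick-sat (x , Px) false)
  ...   | inj₁ eq = false , eq
  ...   | inj₂ first≡y with cover (pick-sat (x , Px) true)
  ...     | inj₁ eq = true , eq
  ...     | inj₂ second≡y = contradiction (trans first≡y (sym second≡y))
              (pick-distinct Px (pick-sat (x , Px) false) λ { refl → x≢y first≡y })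

-- Derived sets and degrees in a graph with loops.

module Graph {n} {E : Fin n → Fin n → Set} (E? : ∀ x y → Dec (E x y))
             (E-sym : ∀ {x y} → E x y → E y x) (E-irrefl : ∀ {x} → ¬ E x x) where

  E⇒≢ : ∀ {x y} → E x y → x ≢ y
  E⇒≢ Exy refl = E-irrefl Exy

  -- Vertices in `L` need no neighbour. `L` is a parameter because both the loops and, later, `Near`
  -- take its place.
  Supported : Pred (Fin n) 0ℓ → Subset n → Pred (Fin n) 0ℓ
  Supported L W x = L x ⊎ ∃ λ y → y ∈ W × E x y

  Derived : Pred (Fin n) 0ℓ → Pred (Subset n) 0ℓ
  Derived L W = ∀ x → x ∈ W → Supported L W x

  module _ {L : Pred (Fin n) 0ℓ} where

    supported-mono : ∀ {V W x} → V ⊆ W → Supported L V x → Supported L W x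
    supported-mono V⊆W (inj₁ Lx)             = inj₁ Lx
    supported-mono V⊆W (inj₂ (y , y∈V , e)) = inj₂ (y , V⊆W y∈V , e)

    derived-＋ : ∀ {W q} → Derived L W → Supported L W q → Derived L (W ＋ q)
    derived-＋ dW sq x x∈ with ∈-＋⁻ x∈
    ... | inj₁ refl = supported-mono ∈-＋-old sq
    ... | inj₂ x∈W  = supported-mono ∈-＋-old (dW x x∈W)

    derived-＋-edge : ∀ {W q z} → Derived L W → E q z → Derived L (W ＋ z ＋ q)
    derived-＋-edge {q = q} {z} dW e x x∈ with ∈-＋⁻ x∈
    ... | inj₁ refl = inj₂ (z , ∈-＋-old ∈-＋-new , e)
    ... | inj₂ x∈W＋z with ∈-＋⁻ x∈W＋z
    ...   | inj₁ refl = inj₂ (q , ∈-＋-new , E-sym e)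
    ...   | inj₂ x∈W  = supported-mono (∈-＋-old ∘ ∈-＋-old) (dW x x∈W)

  neighbours : Fin n → List (Fin n)
  neighbours x = filter (E? x) (allFin n)

  degree : Fin n → ℕ
  degree = length ∘ neighbours

  neighbours-unique : ∀ x → Unique (neighbours x)
  neighbours-unique x = Unique.filter⁺ (E? x) (Unique.allFin⁺ n)

  ∈-neighbours⁺ : ∀ {x y} → E x y → y ∈ˡ neighbours x
  ∈-neighbours⁺ = ∈-filter⁺ (E? _) (∈-allFin _)

  ∈-neighbours⁻ : ∀ {x y} → y ∈ˡ neighbours x → E x y
  ∈-neighbours⁻ p = proj₂ (∈-filter⁻ (E? _) {xs = allFin n} p)

  neighboursExcept : Fin n → Fin n → List (Fin n)
  neighboursExcept x y = filter (λ z → ¬? (z ≟ y)) (neighbours x)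

  degree-≤-suc : ∀ x y → degree x ≤ suc (length (neighboursExcept x y))
  degree-≤-suc x y = unique-⊆⇒length-≤ {ys = y ∷ neighboursExcept x y} (neighbours-unique x) λ {z} z∈ →
    case z ≟ y of λ { (yes refl) → here refl ; (no z≢y) → there (∈-filter⁺ (λ z → ¬? (z ≟ y)) z∈ z≢y) }

  length-neighboursExcept-< : ∀ {x y} → E x y → length (neighboursExcept x y) < degree x
  length-neighboursExcept-< {x} {y} e = filter-notAll (λ z → ¬? (z ≟ y)) (neighbours x)
    (Any.map (λ y≡z z≢y → z≢y (sym y≡z)) (∈-neighbours⁺ e))

  -- The degree of `x` is at least two, hence so is that of `t`, and at most one neighbour of `t` is
  -- `u`.
  another-neighbour : ∀ {x y z} t → E x y → E x z → y ≢ z → degree x ≤ degree t →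
    ∀ u → ∃ λ v → E t v × v ≢ u
  another-neighbour {x} {y} {z} t Exy Exz y≢z dx≤dt u with neighboursExcept t u in eq
  ... | v ∷ _ with v∈ , v≢u ← ∈-filter⁻ (λ z → ¬? (z ≟ u)) {xs = neighbours t} (subst (v ∈ˡ_) (sym eq) (here refl)) =
        v , ∈-neighbours⁻ v∈ , v≢u
  ... | [] = contradiction (≤-trans two (≤-trans dx≤dt (subst (λ l → degree t ≤ suc (length l)) eq (degree-≤-suc t u)))) λ { (s≤s ()) }
    where
    two : 2 ≤ degree x
    two = unique-⊆⇒length-≤ {xs = y ∷ z ∷ []} ((y≢z ∷ []) ∷ [] ∷ []) λ
      { (here refl) → ∈-neighbours⁺ Exy ; (there (here refl)) → ∈-neighbours⁺ Exz }

  -- Charging around a vertex of minimal degree.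

  module Charging {L : Pred (Fin n) 0ℓ} (L? : Decidable L) (i : Fin n)
                  (minimal : ∀ {x y} → ¬ L x → E x y → degree i ≤ degree x) where

    supported? : ∀ W → Decidable (Supported L W)
    supported? W x = L? x ⊎-dec any? λ y → y ∈? W ×-dec E? x y

    opaque
      derived? : Decidable (Derived L)
      derived? W = all? λ x → x ∈? W →-dec supported? W x

    Isolated : Subset n → Pred (Fin n) 0ℓ
    Isolated W x = x ∈ W × ¬ L x × (∀ {y} → y ∈ W → ¬ E x y)

    isolated-vertex : ∀ {W} → ¬ Derived L W → ∃ (Isolated W)
    isolated-vertex {W} ¬d with any? (λ x → x ∈? W ×-dec ¬? (supported? W x))
    ... | yes (x , x∈W , ¬s) = x , x∈W , ¬s ∘ inj₁ , λ y∈W e → ¬s (inj₂ (_ , y∈W , e))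
    ... | no ¬∃ = contradiction derived ¬d
      where
      derived : Derived L W
      derived x x∈W with supported? W x
      ... | yes s = s
      ... | no ¬s = contradiction (x , x∈W , ¬s) ¬∃

    -- The vertices that need no further neighbour once `i` is present: `Derived Near D` means that
    -- all vertices of `D` are supported in `D ＋ i`.
    Near : Pred (Fin n) 0ℓ
    Near x = L x ⊎ E x i

    derived-＋-centre : ∀ {W} → Derived Near W → Supported L W i → Derived L (W ＋ i)
    derived-＋-centre nW si x x∈ with ∈-＋⁻ x∈
    ... | inj₁ refl = supported-mono {L} ∈-＋-old si
    ... | inj₂ x∈W with nW x x∈W
    ...   | inj₁ (inj₁ Lx) = inj₁ Lx
    ...   | inj₁ (inj₂ e)  = inj₂ (i , ∈-＋-new , e)
    ...   | inj₂ (y , y∈W , e) = inj₂ (y , ∈-＋-old y∈W , e)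

    Leaf : Subset n → Pred (Fin n) 0ℓ
    Leaf W t = ¬ L t × E i t × t ∈ W × (∀ y → y ∈ W → E t y → y ≡ i)

    opaque
      leaf? : ∀ W → Decidable (Leaf W)
      leaf? W t = ¬? (L? t) ×-dec E? i t ×-dec t ∈? W ×-dec all? λ y → y ∈? W →-dec (E? t y →-dec y ≟ i)

    module Leaves W = Pick i (leaf? W)

    -- The decoder reads `q` off this set; if it is empty, the charged pair has `s ≡ t`.
    Trace : Fin n → Subset n → Pred (Fin n) 0ℓ
    Trace t W x = x ∈ W × E t x × x ≢ i

    opaque
      trace? : ∀ t W → Decidable (Trace t W)
      trace? t W x = x ∈? W ×-dec E? t x ×-dec ¬? (x ≟ i)

    module Traces t W = Pick i (trace? t W)

    -- The shapes of V for a given q: no z is needed, or z is a neighbour of q outside N[t],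
    -- or all neighbours of q lie in N[t] and the traces q , z of V on N(t) have to be told
    -- apart by the Boolean.
    data Partner (t q : Fin n) : Set where
      close : Near q → Partner t q
      outer : ∀ z → ¬ Near q → E q z → z ≢ t → ¬ E t z → Partner t q
      inner : ∀ z → ¬ Near q → E q z → z ≢ t → E t z → Partner t q
      none  : ¬ Near q → (∀ {z} → E q z → z ≡ t) → Partner t q

    partner : ∀ t q → Partner t q
    partner t q with L? q ⊎-dec E? q i
    ... | yes c = close c
    ... | no ¬c with any? (λ z → E? q z ×-dec ¬? (z ≟ t) ×-dec ¬? (E? t z))
    ...   | yes (z , e , z≢t , ¬e) = outer z ¬c e z≢t ¬e
    ...   | no _ with any? (λ z → E? q z ×-dec ¬? (z ≟ t))
    ...     | no ¬z = none ¬c λ {z} e → case z ≟ t of λ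
                { (yes z≡t) → z≡t ; (no z≢t) → contradiction (z , e , z≢t) ¬z }
    ...     | yes (z , e , z≢t) with E? t z
    ...       | yes e′ = inner z ¬c e z≢t e′
    ...       | no ¬e′ = outer z ¬c e z≢t ¬e′

    -- Here V = D or V = D + z, the first Boolean says whether i belongs to the charged set,
    -- the second whether V is derived, and the result is D.
    resolve : Bool → Bool → Bool → Subset n → Fin n → Subset n
    resolve true  true  k     V z = V − z
    resolve true  false true  V z = V − z
    resolve true  false false V z = V
    resolve false true  k     V z = V
    resolve false false k     V z = V − z

    -- Recovers `D` and the transmitted Boolean from the image. In the case `inner` the Boolean `k`
    -- is spent on telling `q` from `z`, so the presence of `i` transmits instead. The value for
    -- `none` is junk.
    core : ∀ {t q} → Partner t q → Subset n → Bool → Subset n × Bool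
    core {q = q} (close _)         W k = W − i − q , k
    core {q = q} (outer z _ _ _ _) W k =
      resolve (does (i ∈? W)) (does (derived? (W − i − q))) k (W − i − q) z , k
    core {q = q} (inner z _ _ _ _) W k = W − i − q − z , does (i ∈? W)
    core         (none _ _)        W k = W , k

    -- D = W − t − i for a leaf t of i in W.
    record Core (t : Fin n) (D : Subset n) : Set where
      field
        Eit    : E i t
        i∉D    : i ∉ D
        t∉D    : t ∉ D
        free   : ∀ {y} → y ∈ D → ¬ E t y
        near   : Derived Near D

    -- Images of a charged pair with `s ≢ t`.

    module _ {t D} (C : Core t D) (si : Supported L D i) where
      open Core C

      -- What the decoder must read off the image: first `q`, then `D`, then `b`. The last is
      -- demanded only for derived `D`, since otherwise `b` follows from which of two leaves `t` is.
      record Encoding {q} (κ : Partner t q) (b : Bool) : Set where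
        constructor encoding
        field
          image     : Subset n
          bit       : Bool
          derived   : Derived L image
          avoids    : t ∉ image
          visible   : q ∈ image
          traced    : Traces.pick t image bit ≡ q
          recovered : proj₁ (core κ image bit) ≡ D
          bit-kept  : Derived L D → proj₂ (core κ image bit) ≡ b

      module _ {q} (Etq : E t q) (q≢i : q ≢ i) where

        t≢i : t ≢ i
        t≢i = ≢-sym (E⇒≢ Eit)

        i≢q : i ≢ q
        i≢q = ≢-sym q≢i

        t≢q : t ≢ q
        t≢q = E⇒≢ Etq

        q∉D : q ∉ D
        q∉D q∈D = free q∈D Etq

        i∉D＋q : i ∉ D ＋ q
        i∉D＋q = ∉-＋ i≢q i∉D

        t∉D＋q : t ∉ D ＋ q
        t∉D＋q = ∉-＋ t≢q t∉D

        traced-by : ∀ {W} k → q ∈ W → (∀ {x} → Trace t W x → x ≡ q) → Traces.pick t W k ≡ q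
        traced-by {W} k q∈W only = only (Traces.pick-sat t W (q , q∈W , Etq , q≢i) k)

        strip : ∀ {V} → i ∉ V → q ∉ V → V ＋ q − i − q ≡ V
        strip i∉V q∉V = trans (cong (_− q) (−-absent (∉-＋ i≢q i∉V))) (＋-−-cancel q∉V)

        strip-centre : ∀ {V} → i ∉ V → q ∉ V → V ＋ q ＋ i − i − q ≡ V
        strip-centre i∉V q∉V = trans (cong (_− q) (＋-−-cancel (∉-＋ i≢q i∉V))) (＋-−-cancel q∉V)

        trace-＋q : ∀ {V} → (∀ {y} → y ∈ V → ¬ E t y) → ∀ {x} → Trace t (V ＋ q) x → x ≡ q
        trace-＋q free (x∈ , e , _) with ∈-＋⁻ x∈
        ... | inj₁ x≡q = x≡q
        ... | inj₂ x∈V = contradiction e (free x∈V)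

        trace-＋i : ∀ {V x} → Trace t (V ＋ i) x → Trace t V x
        trace-＋i (x∈ , e , x≢i) with ∈-＋⁻ x∈
        ... | inj₁ x≡i = contradiction x≡i x≢i
        ... | inj₂ x∈V = x∈V , e , x≢i

        -- With `i` present `q` needs no partner, and `D` misses the neighbours of `t`, so the trace
        -- is `q` alone and the Boolean is free to carry `b`.
        encode-close : (c : Near q) (b : Bool) → Encoding (close c) b
        encode-close c b = encoding (D ＋ q ＋ i) b
          (derived-＋-centre (derived-＋ near (inj₁ c)) (supported-mono {L} ∈-＋-old si))
          (∉-＋ t≢i t∉D＋q)
          (∈-＋-old ∈-＋-new)
          (traced-by b (∈-＋-old ∈-＋-new) (trace-＋q free ∘ trace-＋i))
          (strip-centre i∉D q∉D)
          (λ _ → refl)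

        -- `z` is added only if `q` has no neighbour in `D`, whence `z ∉ D`. If `D` is derived, the
        -- Boolean carries `b`: `i` is omitted from `D ＋ q`, and from `D ＋ z ＋ q` unless `D ＋ z` is
        -- derived, so the presence of `i` and derivability tell the shapes apart. If `D` is not
        -- derived, `i` is added and the Boolean tells `D` from `D ＋ z`.
        encode-outer : ∀ z ¬c Eqz z≢t ¬Etz b → Encoding (outer z ¬c Eqz z≢t ¬Etz) b
        encode-outer z ¬c Eqz z≢t ¬Etz b = go (derived? D) (any? λ y → y ∈? D ×-dec E? q y)
          where
          κ : Partner t q
          κ = outer z ¬c Eqz z≢t ¬Etz

          i≢z : i ≢ z
          i≢z refl = ¬c (inj₂ Eqz)

          i∉D＋z : i ∉ D ＋ z
          i∉D＋z = ∉-＋ i≢z i∉D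

          q∉D＋z : q ∉ D ＋ z
          q∉D＋z = ∉-＋ (E⇒≢ Eqz) q∉D

          t∉D＋z＋q : t ∉ D ＋ z ＋ q
          t∉D＋z＋q = ∉-＋ t≢q (∉-＋ (≢-sym z≢t) t∉D)

          free-z : ∀ {y} → y ∈ D ＋ z → ¬ E t y
          free-z y∈ with ∈-＋⁻ y∈
          ... | inj₁ refl = ¬Etz
          ... | inj₂ y∈D  = free y∈D

          resolved : ∀ {W V a g} k → W − i − q ≡ V → does (i ∈? W) ≡ a → does (derived? V) ≡ g →
            proj₁ (core κ W k) ≡ resolve a g k V z
          resolved k refl refl refl = refl

          z∉D : ¬ (∃ λ y → y ∈ D × E q y) → z ∉ D
          z∉D ¬y z∈D = ¬y (z , z∈D , Eqz)

          centred : ¬ (∃ λ y → y ∈ D × E q y) → ∀ k → resolve true (does (derived? (D ＋ z))) k (D ＋ z) z ≡ D →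
            (Derived L D → k ≡ b) → Encoding κ b
          centred ¬y k eq kept = encoding (D ＋ z ＋ q ＋ i) k
            (derived-＋-centre (derived-＋-edge near Eqz) (supported-mono {L} (∈-＋-old ∘ ∈-＋-old) si))
            (∉-＋ t≢i t∉D＋z＋q)
            (∈-＋-old ∈-＋-new)
            (traced-by k (∈-＋-old ∈-＋-new) (trace-＋q free-z ∘ trace-＋i))
            (trans (resolved k (strip-centre i∉D＋z q∉D＋z) (dec-true (i ∈? _) ∈-＋-new) refl) eq)
            kept

          go : Dec (Derived L D) → Dec (∃ λ y → y ∈ D × E q y) → Encoding κ b
          go (yes dD) (yes (y , y∈D , e)) = encoding (D ＋ q) b
            (derived-＋ dD (inj₂ (y , y∈D , e)))
            t∉D＋q
            ∈-＋-new
            (traced-by b ∈-＋-new (trace-＋q free))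
            (resolved b (strip i∉D q∉D) (dec-false (i ∈? _) i∉D＋q) (dec-true (derived? D) dD))
            (λ _ → refl)
          go (yes dD) (no ¬y) with derived? (D ＋ z) in eq
          ... | yes _ = centred ¬y b
            (trans (cong (λ d → resolve true (does d) b (D ＋ z) z) eq) (＋-−-cancel (z∉D ¬y)))
            (λ _ → refl)
          ... | no ¬d = encoding (D ＋ z ＋ q) b
            (derived-＋-edge dD Eqz)
            t∉D＋z＋q
            ∈-＋-new
            (traced-by b ∈-＋-new (trace-＋q free-z))
            (trans (resolved b (strip i∉D＋z q∉D＋z) (dec-false (i ∈? _) (∉-＋ i≢q i∉D＋z)) (cong does eq))
                   (＋-−-cancel (z∉D ¬y)))
            (λ _ → refl)
          go (no ¬dD) (yes (y , y∈D , e)) = encoding (D ＋ q ＋ i) false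
            (derived-＋-centre (derived-＋ near (inj₂ (y , y∈D , e))) (supported-mono {L} ∈-＋-old si))
            (∉-＋ t≢i t∉D＋q)
            (∈-＋-old ∈-＋-new)
            (traced-by false (∈-＋-old ∈-＋-new) (trace-＋q free ∘ trace-＋i))
            (resolved false (strip-centre i∉D q∉D) (dec-true (i ∈? _) ∈-＋-new) (dec-false (derived? D) ¬dD))
            (λ dD → contradiction dD ¬dD)
          go (no ¬dD) (no ¬y) = centred ¬y true (either (derived? (D ＋ z))) (λ dD → contradiction dD ¬dD)
            where
            either : (d : Dec (Derived L (D ＋ z))) → resolve true (does d) true (D ＋ z) z ≡ D
            either (yes _) = ＋-−-cancel (z∉D ¬y)
            either (no _)  = ＋-−-cancel (z∉D ¬y)

        -- The trace is `q` and `z`, and the Boolean points at `q`. For derived `D` both the set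
        -- without `i` and the set with `i` are derived, and this choice carries `b`; otherwise `i`
        -- is added and `b` is dropped.
        encode-inner : ∀ z ¬c Eqz z≢t Etz b → Encoding (inner z ¬c Eqz z≢t Etz) b
        encode-inner z ¬c Eqz z≢t Etz b = go (derived? D) b refl
          where
          κ : Partner t q
          κ = inner z ¬c Eqz z≢t Etz

          i≢z : i ≢ z
          i≢z refl = ¬c (inj₂ Eqz)

          i∉D＋z : i ∉ D ＋ z
          i∉D＋z = ∉-＋ i≢z i∉D

          q∉D＋z : q ∉ D ＋ z
          q∉D＋z = ∉-＋ (E⇒≢ Eqz) q∉D

          z∉D : z ∉ D
          z∉D z∈D = free z∈D Etz

          t∉D＋z＋q : t ∉ D ＋ z ＋ q
          t∉D＋z＋q = ∉-＋ t≢q (∉-＋ (≢-sym z≢t) t∉D)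

          cover : ∀ {x} → Trace t (D ＋ z ＋ q) x → x ≡ q ⊎ x ≡ z
          cover (x∈ , e , _) with ∈-＋⁻ x∈
          ... | inj₁ x≡q = inj₁ x≡q
          ... | inj₂ x∈D＋z with ∈-＋⁻ x∈D＋z
          ...   | inj₁ x≡z = inj₂ x≡z
          ...   | inj₂ x∈D = contradiction e (free x∈D)

          centred : (Derived L D → true ≡ b) → Encoding κ b
          centred kept with k , traced ← Traces.pick-onto t (D ＋ z ＋ q ＋ i) (∈-＋-old ∈-＋-new , Etq , q≢i) (cover ∘ trace-＋i) =
            encoding (D ＋ z ＋ q ＋ i) k
              (derived-＋-centre (derived-＋-edge near Eqz) (supported-mono {L} (∈-＋-old ∘ ∈-＋-old) si))
              (∉-＋ t≢i t∉D＋z＋q)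
              (∈-＋-old ∈-＋-new)
              traced
              (trans (cong (_− z) (strip-centre i∉D＋z q∉D＋z)) (＋-−-cancel z∉D))
              (λ dD → trans (dec-true (i ∈? _) ∈-＋-new) (kept dD))

          go : Dec (Derived L D) → ∀ c → c ≡ b → Encoding κ b
          go (no ¬dD) _    _   = centred λ dD → contradiction dD ¬dD
          go (yes dD) true c≡b = centred λ _ → c≡b
          go (yes dD) false c≡b with k , traced ← Traces.pick-onto t (D ＋ z ＋ q) (∈-＋-new , Etq , q≢i) cover =
            encoding (D ＋ z ＋ q) k
              (derived-＋-edge dD Eqz)
              t∉D＋z＋q
              ∈-＋-new
              traced
              (trans (cong (_− z) (strip i∉D＋z q∉D＋z)) (＋-−-cancel z∉D))
              (λ _ → trans (dec-false (i ∈? _) (∉-＋ i≢q i∉D＋z)) c≡b)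

        encode : ∀ {s} → E i s → s ≢ t → (κ : Partner t q) (b : Bool) → Encoding κ b
        encode Eis s≢t (close c) = encode-close c
        encode Eis s≢t (outer z ¬c Eqz z≢t ¬Etz) = encode-outer z ¬c Eqz z≢t ¬Etz
        encode Eis s≢t (inner z ¬c Eqz z≢t Etz)  = encode-inner z ¬c Eqz z≢t Etz
        -- Impossible: `q` is no loop, so its degree is at least that of `i`, which has the distinct
        -- neighbours `s` and `t`.
        encode Eis s≢t (none ¬c only)
          with z , Eqz , z≢t ← another-neighbour q Eis Eit s≢t (minimal (¬c ∘ inj₁) (E-sym Etq)) t =
          contradiction (only Eqz) z≢t

    -- The decoding map.

    -- An arbitrary surjection from N(t) ∖ {i} onto N(i) ∖ {t}, for non-loops t adjacent to i.
    transfer : Fin n → Fin n → Fin n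
    transfer t = zipLookup _≟_ (neighboursExcept i t) (neighboursExcept t i)

    -- Minimality gives `degree i ≤ degree t`, and deleting one neighbour on each side keeps the
    -- inequality.
    transfer-onto : ∀ {s t} → ¬ L t → E i t → E i s → s ≢ t → ∃ λ q → E t q × q ≢ i × transfer t q ≡ s
    transfer-onto {s} {t} ¬Lt Eit Eis s≢t
      with q , q∈ , eq ← zipLookup-onto _≟_ (Unique.filter⁺ (λ z → ¬? (z ≟ i)) (neighbours-unique t))
             (s≤s⁻¹ (≤-trans (length-neighboursExcept-< Eit)
                      (≤-trans (minimal ¬Lt (E-sym Eit)) (degree-≤-suc t i))))
             (∈-filter⁺ (λ z → ¬? (z ≟ t)) (∈-neighbours⁺ Eis) s≢t)
      with q∈N , q≢i ← ∈-filter⁻ (λ z → ¬? (z ≟ i)) {xs = neighbours t} q∈ =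
      q , ∈-neighbours⁻ q∈N , q≢i , eq

    -- Serves both sides: a charged pair `(s , W)` or a receiving pair `(t , V)`, each with its
    -- Boolean.
    Code : Set
    Code = Fin n × Subset n × Bool

    tracedCode : Fin n → Subset n → Bool → Fin n → Code
    tracedCode t W k q = transfer t q , core (partner t q) W k

    -- The intermediate result `(s , D , c)`: a non-empty trace reveals `q` and through it `s`, an
    -- empty one means `s ≡ t`.
    raw : Code → Code
    raw (t , W , k) =
      if does (any? (trace? t W)) then tracedCode t W k (Traces.pick t W k) else (t , W − i , k)

    raw-traced : ∀ {t W k} → ∃ (Trace t W) → raw (t , W , k) ≡ tracedCode t W k (Traces.pick t W k)
    raw-traced {t} {W} trace rewrite dec-true (any? (trace? t W)) trace = refl

    raw-untraced : ∀ {t W k} → ¬ ∃ (Trace t W) → raw (t , W , k) ≡ (t , W − i , k)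
    raw-untraced {t} {W} ¬trace rewrite dec-false (any? (trace? t W)) ¬trace = refl

    -- If D is derived its Boolean has been transmitted; otherwise i has two leaves in W
    -- and the Boolean tells which one is t.
    assemble : Fin n → Code → Code
    assemble t (s , D , c) =
      s , D ＋ i ＋ t , (if does (derived? D) then c else does (t ≟ Leaves.second (D ＋ i ＋ t)))

    opaque
      decode : Code → Code
      decode (t , W , k) = assemble t (raw (t , W , k))

    Blocked : Fin n → Pred (Subset n) 0ℓ
    Blocked s W = s ∈ W × i ∈ W × ¬ Derived L (W − i)

    -- Preimages of a charged pair under `decode`.

    module _ {s W} (dW : Derived L W) (Eis : E i s) (blocked : Blocked s W) (b : Bool) where

      s∈W = proj₁ blocked
      i∈W = proj₁ (proj₂ blocked)

      -- A vertex isolated in `W − i` is supported in `W`, and only `i` can support it.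
      leaf-exists : ∃ (Leaf W)
      leaf-exists with x , x∈W−i , ¬Lx , iso ← isolated-vertex (proj₂ (proj₂ blocked))
                  with x∈W , x≢i ← ∈-−⁻ x∈W−i
                  with dW x x∈W
      ... | inj₁ Lx = contradiction Lx ¬Lx
      ... | inj₂ (y , y∈W , Exy) = x , ¬Lx , E-sym (subst (E x) (only y y∈W Exy) Exy) , x∈W , only
        where
        only : ∀ y → y ∈ W → E x y → y ≡ i
        only y y∈W Exy with y ≟ i
        ... | yes y≡i = y≡i
        ... | no y≢i  = contradiction Exy (iso (∈-−⁺ y∈W y≢i))

      open Leaves W using (pick; pick-sat; pick-distinct; first; second)

      -- If `W` has at least two leaves, the two copies of `(s , W)` are charged to different ones.
      t : Fin n
      t = pick b

      leaf : Leaf W t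
      leaf = pick-sat leaf-exists b

      ¬Lt = proj₁ leaf
      Eit = proj₁ (proj₂ leaf)
      t∈W = proj₁ (proj₂ (proj₂ leaf))
      t-only = proj₂ (proj₂ (proj₂ leaf))

      D : Subset n
      D = W − t − i

      ∈D⁻ : ∀ {y} → y ∈ D → y ∈ W × y ≢ t × y ≢ i
      ∈D⁻ y∈D with y∈ , y≢i ← ∈-−⁻ y∈D with y∈W , y≢t ← ∈-−⁻ y∈ = y∈W , y≢t , y≢i

      D-restore : D ＋ i ＋ t ≡ W
      D-restore = trans (cong (_＋ t) (−-＋-cancel (∈-−⁺ i∈W (E⇒≢ Eit)))) (−-＋-cancel t∈W)

      D-free : ∀ {y} → y ∈ D → ¬ E t y
      D-free y∈D e with y∈W , _ , y≢i ← ∈D⁻ y∈D = y≢i (t-only _ y∈W e)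

      -- Removing `t` costs no vertex of `D` its support, as none is adjacent to `t`; the loss of
      -- `i` is absorbed by `Near`.
      D-near : Derived Near D
      D-near x x∈D with x∈W , _ ← ∈D⁻ x∈D with dW x x∈W
      ... | inj₁ Lx = inj₁ (inj₁ Lx)
      ... | inj₂ (y , y∈W , e) with y ≟ i | y ≟ t
      ...   | yes refl | _        = inj₁ (inj₂ e)
      ...   | no _     | yes refl = contradiction (E-sym e) (D-free x∈D)
      ...   | no y≢i   | no y≢t   = inj₂ (y , ∈-−⁺ (∈-−⁺ y∈W y≢t) y≢i , e)

      D-core : Core t D
      D-core = record
        { Eit = Eit ; i∉D = λ i∈ → proj₂ (proj₂ (∈D⁻ i∈)) refl ; t∉D = λ t∈ → proj₁ (proj₂ (∈D⁻ t∈)) refl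
        ; free = D-free ; near = D-near }

      -- By `D-near` an isolated vertex of `D` can only have been supported by `i`, which makes it a
      -- leaf other than `t`.
      isolated-in-D : ¬ Derived L D → ∃ λ x → x ∈ D × E i x × Leaf W x
      isolated-in-D ¬dD with x , x∈D , ¬Lx , iso ← isolated-vertex ¬dD
                        with x∈W , _ ← ∈D⁻ x∈D
                        with D-near x x∈D
      ... | inj₂ (y , y∈D , e) = contradiction e (iso y∈D)
      ... | inj₁ (inj₁ Lx)     = contradiction Lx ¬Lx
      ... | inj₁ (inj₂ Exi)    = x , x∈D , E-sym Exi , ¬Lx , E-sym Exi , x∈W , only
        where
        only : ∀ y → y ∈ W → E x y → y ≡ i
        only y y∈W e with y ≟ i | y ≟ t
        ... | yes y≡i | _        = y≡i
        ... | no _    | yes refl = contradiction (E-sym e) (D-free x∈D)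
        ... | no y≢i  | no y≢t   = contradiction e (iso (∈-−⁺ (∈-−⁺ y∈W y≢t) y≢i))

      two-leaves : ¬ Derived L D → first ≢ second
      two-leaves ¬dD with x , x∈D , _ , leaf-x ← isolated-in-D ¬dD =
        pick-distinct leaf-x leaf (proj₁ (proj₂ (∈D⁻ x∈D)))

      bit-recovered : ∀ {c} → (Derived L D → c ≡ b) →
        (if does (derived? D) then c else does (t ≟ second)) ≡ b
      bit-recovered kept with derived? D
      ... | yes dD = kept dD
      ... | no ¬dD = go b refl
        where
        go : ∀ b′ → b ≡ b′ → does (pick b ≟ second) ≡ b
        go true  refl = dec-true (second ≟ second) refl
        go false refl = dec-false (first ≟ second) (two-leaves ¬dD)

      opaque
        unfolding decode

        decoded : ∀ {V k c} → raw (t , V , k) ≡ (s , D , c) → (Derived L D → c ≡ b) →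
          decode (t , V , k) ≡ (s , W , b)
        decoded {c = c} raw-V kept = trans (cong (assemble t) raw-V) (cong (s ,_) (cong₂ _,_ D-restore
          (trans (cong (λ V → if does (derived? D) then c else does (t ≟ Leaves.second V)) D-restore)
                 (bit-recovered kept))))

      Preimage : Set
      Preimage = ∃ λ t → ∃₂ λ V k → E i t × Derived L V × t ∉ V × decode (t , V , k) ≡ (s , W , b)

      -- `D` and `D ＋ i` have empty trace. If `D` is not derived, `i` restores the lost support and
      -- is itself supported by the second leaf.
      preimage-leaf : s ≡ t → Preimage
      preimage-leaf refl with derived? D
      ... | yes dD = t , D , b , Eit , dD , Core.t∉D D-core ,
        decoded (trans
          (raw-untraced λ (_ , y∈D , e , _) → D-free y∈D e)
          (cong (λ V → t , V , b) (−-absent (Core.i∉D D-core)))) (λ _ → refl)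
      ... | no ¬dD with x , x∈D , Eix , _ ← isolated-in-D ¬dD =
        t , D ＋ i , b , Eit , derived-＋-centre D-near (inj₂ (x , x∈D , Eix)) ,
        ∉-＋ (≢-sym (E⇒≢ Eit)) (Core.t∉D D-core) ,
        decoded (trans
          (raw-untraced λ (_ , y∈ , e , y≢i) → case ∈-＋⁻ y∈ of λ
            { (inj₁ y≡i) → y≢i y≡i ; (inj₂ y∈D) → D-free y∈D e })
          (cong (λ V → t , V , b) (＋-−-cancel (Core.i∉D D-core)))) (λ _ → refl)

      -- Being neither `t` nor `i`, `s` stays in `D` and supports `i` there.
      preimage-other : s ≢ t → Preimage
      preimage-other s≢t
        with q , Etq , q≢i , q↦s ← transfer-onto ¬Lt Eit Eis s≢t
        with encoding V k dV t∉V q∈V traced recovered kept ←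
             encode D-core (inj₂ (s , ∈-−⁺ (∈-−⁺ s∈W s≢t) (≢-sym (E⇒≢ Eis)) , Eis)) Etq q≢i Eis s≢t (partner t q) b =
        t , V , k , Eit , dV , t∉V ,
        decoded (trans
          (raw-traced (q , q∈V , Etq , q≢i))
          (trans (cong (tracedCode t V k) traced)
                 (cong₂ (λ r D′ → r , D′ , proj₂ (core (partner t q) V k)) q↦s recovered))) kept

      preimage : Preimage
      preimage with s ≟ t
      ... | yes s≡t = preimage-leaf s≡t
      ... | no s≢t  = preimage-other s≢t

    -- A light edge at the centre.

    module Light (M : List (Subset n)) (M-unique : Unique M)
             (M-sound : ∀ {W} → W ∈ˡ M → Derived L W) (M-complete : ∀ {W} → Derived L W → W ∈ˡ M) where

      private
        blocked? : ∀ s → Decidable (Blocked s)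
        blocked? s W = s ∈? W ×-dec i ∈? W ×-dec ¬? (derived? (W − i))

        avoiding? : ∀ (s : Fin n) → Decidable (s ∉_)
        avoiding? s W = ¬? (s ∈? W)

      blockeds avoidings : Fin n → List (Subset n)
      blockeds s  = filter (blocked? s) M
      avoidings s = filter (avoiding? s) M

      sources targets : Fin n → List (Subset n × Bool)
      sources s = cartesianProduct (blockeds s) (false ∷ true ∷ [])
      targets s = cartesianProduct (avoidings s) (false ∷ true ∷ [])

      -- Every source is decoded from a target; in numbers, `2 Σ b(s) ≤ 2 Σ c(s)` over the
      -- neighbours `s` of `i`.
      total-sources-≤-targets : length (tagged (neighbours i) sources) ≤ length (tagged (neighbours i) targets)
      total-sources-≤-targets = length-≤-by-decoding decode
        (tagged-unique sources (neighbours-unique i) λ s →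
          Unique.cartesianProduct⁺ (Unique.filter⁺ (blocked? s) M-unique) (((λ ()) ∷ []) ∷ [] ∷ []))
        cover
        where
        ∈-Bool : ∀ b → b ∈ˡ false ∷ true ∷ []
        ∈-Bool false = here refl
        ∈-Bool true  = there (here refl)

        cover : ∀ {x} → x ∈ˡ tagged (neighbours i) sources → ∃ λ y → y ∈ˡ tagged (neighbours i) targets × decode y ≡ x
        cover {s , W , b} x∈
          with s∈ , Wb∈ ← ∈-tagged⁻ (neighbours i) sources x∈
          with W∈ , _ ← ∈-cartesianProduct⁻ (blockeds s) _ Wb∈
          with W∈M , blocked ← ∈-filter⁻ (blocked? s) {xs = M} W∈
          with t , V , k , Eit , dV , t∉V , eq ← preimage (M-sound W∈M) (∈-neighbours⁻ s∈) blocked b =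
          (t , V , k) ,
          ∈-tagged⁺ targets (∈-neighbours⁺ Eit)
            (∈-cartesianProduct⁺ (∈-filter⁺ (avoiding? t) (M-complete dV) t∉V) (∈-Bool k)) ,
          eq

      -- Averaging: if the inequality failed at every neighbour, the sums would compare strictly the
      -- other way, there being a neighbour `t`.
      blocked-≤-avoiding : ∀ {t} → E i t → ∃ λ s → E i s × length (blockeds s) ≤ length (avoidings s)
      blocked-≤-avoiding Eit with Any.any? (λ s → length (blockeds s) ≤? length (avoidings s)) (neighbours i)
      ... | yes light with s , s∈ , le ← find light = s , ∈-neighbours⁻ s∈ , le
      ... | no heavy = contradiction total-sources-≤-targets (<⇒≱
        (length-tagged-< (neighbours i) targets sources (∈-neighbours⁺ Eit) λ {s} s∈ →
          subst₂ _<_ (sym (length-cartesianProduct-Bool (avoidings s))) (sym (length-cartesianProduct-Bool (blockeds s)))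
            (*-monoˡ-< 2 (≰⇒> λ le → heavy (lose s∈ le)))))

      both? : ∀ (s : Fin n) → Decidable (λ W → s ∈ W × i ∈ W)
      both? s W = s ∈? W ×-dec i ∈? W

      -- Unless W ∋ s , i is blocked, removing i from W gives a derived set again.
      blocked-≤-avoiding⇒light : ∀ {s} → E i s → length (blockeds s) ≤ length (avoidings s) →
        2 * length (filter (both? s) M) ≤ length M
      blocked-≤-avoiding⇒light {s} Eis le = begin
        2 * #both                           ≡⟨ cong (#both +_) (+-identityʳ #both) ⟩
        #both + #both                       ≤⟨ +-monoʳ-≤ #both (count-cover (both? s) free? (blocked? s) split M) ⟩
        #both + (length (filter free? M) + length (blockeds s))
                                            ≤⟨ +-monoʳ-≤ #both (+-mono-≤ free≤without le) ⟩
        #both + (#without + #avoiding)      ≡⟨ +-assoc #both #without #avoiding ⟨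
        #both + #without + #avoiding        ≤⟨ +-monoˡ-≤ #avoiding
                                                 (count-disjoint (both? s) without? (s ∈?_)
                                                   (λ (_ , i∈) (_ , i∉) → i∉ i∈) proj₁ proj₁ M) ⟩
        length (filter (s ∈?_) M) + #avoiding
                                            ≤⟨ count-disjoint (s ∈?_) (avoiding? s) U?
                                                 (λ s∈ s∉ → s∉ s∈) (λ _ → tt) (λ _ → tt) M ⟩
        length (filter U? M)                ≤⟨ length-filter U? M ⟩
        length M                            ∎
        where
        open ≤-Reasoning

        free? : Decidable (λ W → s ∈ W × i ∈ W × Derived L (W − i))
        free? W = s ∈? W ×-dec i ∈? W ×-dec derived? (W − i)

        without? : Decidable (λ W → s ∈ W × i ∉ W)
        without? W = s ∈? W ×-dec ¬? (i ∈? W)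

        #both #without #avoiding : ℕ
        #both     = length (filter (both? s) M)
        #without  = length (filter without? M)
        #avoiding = length (avoidings s)

        split : ∀ {W} → s ∈ W × i ∈ W → (s ∈ W × i ∈ W × Derived L (W − i)) ⊎ Blocked s W
        split {W} (s∈ , i∈) with derived? (W − i)
        ... | yes d = inj₁ (s∈ , i∈ , d)
        ... | no ¬d = inj₂ (s∈ , i∈ , ¬d)

        free≤without : length (filter free? M) ≤ #without
        free≤without = length-≤-by-decoding (_＋ i) (Unique.filter⁺ free? M-unique) λ {W} W∈ →
          case ∈-filter⁻ free? {xs = M} W∈ of λ (_ , s∈ , i∈ , d) →
            W − i ,
            ∈-filter⁺ without? (M-complete d)
              (∈-−⁺ s∈ (≢-sym (E⇒≢ Eis)) , λ i∈′ → proj₂ (∈-−⁻ i∈′) refl) ,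
            −-＋-cancel i∈

      light-edge : ∀ {t} → E i t → ∃ λ s → E i s × 2 * length (filter (both? s) M) ≤ length M
      light-edge Eit with s , Eis , le ← blocked-≤-avoiding Eit = s , Eis , blocked-≤-avoiding⇒light Eis le

-- The graph of a union-closed family.

module FamilyGraph {n} (F : Family n) (∪-closed : UnionClosed F) (⊥∈F : ⊥ ∈ᶠ F) where

  _∈F? : Decidable (_∈ᶠ F)
  W ∈F? = Any.any? (≡-dec Bool._≟_ W) (members F)

  ⋃-member : ∀ {x : Fin n} (G : List (Subset n)) → x ∈ ⋃ G → ∃ λ V → V ∈ˡ G × x ∈ V
  ⋃-member []      x∈ = contradiction x∈ ∉⊥
  ⋃-member (V ∷ G) x∈ with x∈p∪q⁻ V (⋃ G) x∈
  ... | inj₁ x∈V = V , here refl , x∈V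
  ... | inj₂ x∈⋃ with W , W∈G , x∈W ← ⋃-member G x∈⋃ = W , there W∈G , x∈W

  ⊆-⋃ : ∀ {V} (G : List (Subset n)) → V ∈ˡ G → V ⊆ ⋃ G
  ⊆-⋃ (_ ∷ G) (here refl) x∈ = x∈p∪q⁺ (inj₁ x∈)
  ⊆-⋃ (U ∷ G) (there V∈)  x∈ = x∈p∪q⁺ {p = U} (inj₂ (⊆-⋃ G V∈ x∈))

  -- Some set of `G` contains `x` and lies below `⋃ G ≡ U`, so it equals `U` by minimality.
  minimal⇒J : ∀ {U x} → U ∈ᶠ F → x ∈ U → (∀ {V} → V ∈ᶠ F → x ∈ V → V ⊆ U → V ≡ U) → J F U
  minimal⇒J {U} {x} U∈F x∈U min = (U∈F , generates) , (x , x∈U)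
    where
    generates : ∀ G → _ → _ → ⋃ G ≡ U → U ∈ˡ G
    generates G G⊆F _ refl with V , V∈G , x∈V ← ⋃-member G x∈U =
      subst (_∈ˡ G) (min (G⊆F V∈G) x∈V (⊆-⋃ G V∈G)) V∈G

  Loop : Pred (Fin n) 0ℓ
  Loop x = ⁅ x ⁆ ∈ᶠ F

  -- The pair need not be a generator: two distinct loops also form an edge.
  E : Fin n → Fin n → Set
  E x y = x ≢ y × (⁅ x ⁆ ∪ ⁅ y ⁆) ∈ᶠ F

  E? : ∀ x y → Dec (E x y)
  E? x y = ¬? (x ≟ y) ×-dec ((⁅ x ⁆ ∪ ⁅ y ⁆) ∈F?)

  E-sym : ∀ {x y} → E x y → E y x
  E-sym {x} {y} (x≢y , xy∈F) = ≢-sym x≢y , subst (_∈ᶠ F) (∪-comm ⁅ x ⁆ ⁅ y ⁆) xy∈F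

  open Graph E? E-sym (λ (x≢x , _) → x≢x refl) public

  ⋃-closed : ∀ G → All (_∈ᶠ F) G → ⋃ G ∈ᶠ F
  ⋃-closed []      []          = ⊥∈F
  ⋃-closed (V ∷ G) (V∈F ∷ G⊆F) = ∪-closed V (⋃ G) V∈F (⋃-closed G G⊆F)

  -- `W` is the union of the members of `F` that it contains.
  locally-generated : ∀ W → (∀ x → x ∈ W → ∃ λ V → V ∈ᶠ F × x ∈ V × V ⊆ W) → W ∈ᶠ F
  locally-generated W local = subst (_∈ᶠ F) (⊆-antisym ⋃⊆W W⊆⋃) (⋃-closed below (All.tabulate (proj₁ ∘ ∈-filter⁻ (_⊆? W))))
    where
    below : List (Subset n)
    below = filter (_⊆? W) (members F)

    ⋃⊆W : ⋃ below ⊆ W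
    ⋃⊆W x∈ with V , V∈ , x∈V ← ⋃-member below x∈ = proj₂ (∈-filter⁻ (_⊆? W) {xs = members F} V∈) x∈V

    W⊆⋃ : W ⊆ ⋃ below
    W⊆⋃ {x} x∈W with V , V∈F , x∈V , V⊆W ← local x x∈W = ⊆-⋃ below (∈-filter⁺ (_⊆? W) V∈F V⊆W) x∈V

  derived⇒member : ∀ {W} → Derived Loop W → W ∈ᶠ F
  derived⇒member {W} dW = locally-generated W λ x x∈W → case dW x x∈W of λ
    { (inj₁ x∈F) → ⁅ x ⁆ , x∈F , x∈⁅x⁆ x , λ {_} → singleton-⊆ x∈W
    ; (inj₂ (y , y∈W , _ , xy∈F)) → ⁅ x ⁆ ∪ ⁅ y ⁆ , xy∈F , x∈p∪q⁺ (inj₁ (x∈⁅x⁆ x)) , λ {_} → pair-⊆ x∈W y∈W }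

  -- Descent on cardinality ends at a minimal member through `x`, which is a generator by
  -- `minimal⇒J`.
  generator-below : ∀ {W x} → W ∈ᶠ F → x ∈ W → ∃ λ U → J F U × x ∈ U × U ⊆ W
  generator-below {W} = go (<-wellFounded ∣ W ∣)
    where
    go : ∀ {W x} → Acc _<_ ∣ W ∣ → W ∈ᶠ F → x ∈ W → ∃ λ U → J F U × x ∈ U × U ⊆ W
    go {W} {x} (acc rec) W∈F x∈W with Any.any? (λ V → x ∈? V ×-dec V ⊂? W) (members F)
    ... | yes smaller with V , V∈F , x∈V , V⊂W ← find smaller
                      with U , JU , x∈U , U⊆V ← go (rec (p⊂q⇒∣p∣<∣q∣ V⊂W)) V∈F x∈V =
          U , JU , x∈U , proj₁ V⊂W ∘ U⊆V
    ... | no ¬smaller = W , minimal⇒J W∈F x∈W min , x∈W , id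
      where
      min : ∀ {V} → V ∈ᶠ F → x ∈ V → V ⊆ W → V ≡ W
      min {V} V∈F x∈V V⊆W = ⊆-antisym V⊆W W⊆V
        where
        W⊆V : W ⊆ V
        W⊆V {y} y∈W with y ∈? V
        ... | yes y∈V = y∈V
        ... | no y∉V  = contradiction (lose V∈F (x∈V , (λ {_} → V⊆W) , y , y∈W , y∉V)) ¬smaller

  module _ (graph : IsGraph (J F)) where

    -- A generator `U` with `x ∈ U ⊆ W` has at most two elements, hence is `⁅ x ⁆` or a pair.
    member⇒derived : ∀ {W} → W ∈ᶠ F → Derived Loop W
    member⇒derived W∈F x x∈W with U , JU@((U∈F , _) , _) , x∈U , U⊆W ← generator-below W∈F x∈W
                             with any? (λ y → y ∈? U ×-dec ¬? (y ≟ x))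
    ... | no ¬other = inj₁ (subst (_∈ᶠ F) (⊆-antisym only (singleton-⊆ x∈U)) U∈F)
      where
      only : U ⊆ ⁅ x ⁆
      only {y} y∈U with y ≟ x
      ... | yes refl = x∈⁅x⁆ x
      ... | no y≢x   = contradiction (y , y∈U , y≢x) ¬other
    ... | yes (y , y∈U , y≢x) = inj₂ (y , U⊆W y∈U , ≢-sym y≢x , subst (_∈ᶠ F) (⊆-antisym only (pair-⊆ x∈U y∈U)) U∈F)
      where
      only : U ⊆ ⁅ x ⁆ ∪ ⁅ y ⁆
      only {z} z∈U with z ≟ x | z ≟ y
      ... | yes refl | _        = x∈p∪q⁺ (inj₁ (x∈⁅x⁆ x))
      ... | no _     | yes refl = x∈p∪q⁺ {p = ⁅ x ⁆} (inj₂ (x∈⁅x⁆ y))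
      ... | no z≢x   | no z≢y   = contradiction (graph U JU) (<⇒≱ three)
        where
        y∈U′ : y ∈ U - x
        y∈U′ = x∈p∧x≢y⇒x∈p-y y∈U y≢x

        ∈U″ : z ∈ U - x - y
        ∈U″ = x∈p∧x≢y⇒x∈p-y (x∈p∧x≢y⇒x∈p-y z∈U z≢x) z≢y

        -- Three strict drops: `x`, `y` and `z` are removed from `U` in turn.
        three : 2 < ∣ U ∣
        three = ≤-trans (s≤s (≤-trans (s≤s (≤-trans (s≤s z≤n) (x∈p⇒∣p-x∣<∣p∣ ∈U″))) (x∈p⇒∣p-x∣<∣p∣ y∈U′))) (x∈p⇒∣p-x∣<∣p∣ x∈U)

    Rough : Pred (Fin n) 0ℓ
    Rough x = ¬ Loop x × ∃ (E x)

    rough? : Decidable Rough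
    rough? x = ¬? (⁅ x ⁆ ∈F?) ×-dec any? (E? x)

    -- Every element of a member is a loop, so deleting `x` maps the members above `⁅ x ⁆`
    -- injectively to members avoiding `x`.
    all-loops⇒density : ¬ ∃ Rough → Satisfiable (J F) → DensityProperty F
    all-loops⇒density ¬rough (U , (U∈F , _) , x , x∈U) = ⁅ x ⁆ , minimal⇒J (loop U∈F x∈U) (x∈⁅x⁆ x) min , (begin
      2 * #above                      ≡⟨ cong (#above +_) (+-identityʳ #above) ⟩
      #above + #above                 ≤⟨ +-monoʳ-≤ #above above≤avoiding ⟩
      #above + length (filter avoiding? (members F))
                                      ≤⟨ count-disjoint (⁅ x ⁆ ⊆?_) avoiding? U? (λ x⊆W x∉W → x∉W (x⊆W (x∈⁅x⁆ x)))
                                           (λ _ → tt) (λ _ → tt) (members F) ⟩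
      length (filter U? (members F))  ≤⟨ length-filter U? (members F) ⟩
      card F                          ∎)
      where
      open ≤-Reasoning

      #above : ℕ
      #above = countAbove F ⁅ x ⁆

      loop : ∀ {W y} → W ∈ᶠ F → y ∈ W → Loop y
      loop {W} {y} W∈F y∈W with ⁅ y ⁆ ∈F? | member⇒derived W∈F y y∈W
      ... | yes l | _                = l
      ... | no _  | inj₁ l           = l
      ... | no ¬l | inj₂ (z , _ , e) = contradiction (y , ¬l , z , e) ¬rough

      min : ∀ {V} → V ∈ᶠ F → x ∈ V → V ⊆ ⁅ x ⁆ → V ≡ ⁅ x ⁆
      min _ x∈V V⊆x = ⊆-antisym V⊆x (singleton-⊆ x∈V)

      avoiding? : Decidable (x ∉_)
      avoiding? W = ¬? (x ∈? W)

      above≤avoiding : #above ≤ length (filter avoiding? (members F))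
      above≤avoiding = length-≤-by-decoding (_＋ x) (Unique.filter⁺ (⁅ x ⁆ ⊆?_) (unique F)) λ {W} W∈ →
        case ∈-filter⁻ (⁅ x ⁆ ⊆?_) {xs = members F} W∈ of λ (W∈F , x⊆W) →
          W − x ,
          ∈-filter⁺ avoiding? (derived⇒member λ y y∈ → inj₁ (loop W∈F (proj₁ (∈-−⁻ y∈)))) (x∉W−x W x) ,
          −-＋-cancel (x⊆W (x∈⁅x⁆ x))

    -- An edge at the non-loop `i` is minimal among the members through `i`, hence a generator, so
    -- the light edge is a witness.
    rough⇒density : ∃ Rough → DensityProperty F
    rough⇒density (x₀ , rough₀) =
      let s , Eis , light = light-edge (proj₂ (proj₂ rough-i)) in
      ⁅ s ⁆ ∪ ⁅ i ⁆ ,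
      minimal⇒J (proj₂ (E-sym Eis)) (x∈p∪q⁺ {p = ⁅ s ⁆} (inj₂ (x∈⁅x⁆ i))) (min Eis) ,
      subst (λ xs → 2 * length xs ≤ card F)
        (filter-≐ (both? s) ((⁅ s ⁆ ∪ ⁅ i ⁆) ⊆?_) ((λ (s∈ , i∈) → pair-⊆ s∈ i∈) , within) (members F)) light
      where
      -- The default `x₀` of `argmin` is itself rough, so `i` is rough in any case.
      i : Fin n
      i = argmin degree x₀ (filter rough? (allFin n))

      rough-i : Rough i
      rough-i = argmin-all degree rough₀ (All.tabulate (proj₂ ∘ ∈-filter⁻ rough? {xs = allFin n}))

      i-minimal : ∀ {x y} → ¬ Loop x → E x y → degree i ≤ degree x
      i-minimal {x} {y} ¬l e = All.lookup (f[argmin]≤f[xs] {f = degree} x₀ (filter rough? (allFin n)))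
        (∈-filter⁺ rough? (∈-allFin x) (¬l , y , e))

      open Charging (λ x → ⁅ x ⁆ ∈F?) i i-minimal using (module Light)
      open Light (members F) (unique F) (member⇒derived) derived⇒member using (light-edge; both?)

      within : ∀ {s W} → ⁅ s ⁆ ∪ ⁅ i ⁆ ⊆ W → s ∈ W × i ∈ W
      within {s} si⊆W = si⊆W (x∈p∪q⁺ (inj₁ (x∈⁅x⁆ s))) , si⊆W (x∈p∪q⁺ {p = ⁅ s ⁆} (inj₂ (x∈⁅x⁆ i)))

      -- The only other candidate is `⁅ i ⁆`, and `i` is no loop.
      min : ∀ {s V} → E i s → V ∈ᶠ F → i ∈ V → V ⊆ ⁅ s ⁆ ∪ ⁅ i ⁆ → V ≡ ⁅ s ⁆ ∪ ⁅ i ⁆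
      min {s} {V} Eis V∈F i∈V V⊆si with s ∈? V
      ... | yes s∈V = ⊆-antisym V⊆si (pair-⊆ s∈V i∈V)
      ... | no s∉V  = contradiction (subst (_∈ᶠ F) V≡i V∈F) (proj₁ rough-i)
        where
        V≡i : V ≡ ⁅ i ⁆
        V≡i = ⊆-antisym
          (λ y∈V → case x∈p∪q⁻ ⁅ s ⁆ ⁅ i ⁆ (V⊆si y∈V) of λ
            { (inj₁ y∈s) → contradiction (subst (_∈ V) (x∈⁅y⁆⇒x≡y s y∈s) y∈V) s∉V ; (inj₂ y∈i) → y∈i })
          (singleton-⊆ i∈V)

theorem4p11p2 : ∀ (n : ℕ) (F : Family n) → UnionClosed F → ⊥ ∈ᶠ F →
    Satisfiable (J F) → IsGraph (J F) → DensityProperty F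
theorem4p11p2 n F ∪-closed ⊥∈F J-nonempty graph with any? (FamilyGraph.rough? F ∪-closed ⊥∈F graph)
... | yes rough = FamilyGraph.rough⇒density F ∪-closed ⊥∈F graph rough
... | no ¬rough = FamilyGraph.all-loops⇒density F ∪-closed ⊥∈F graph ¬rough J-nonempty
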